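{- For every digraph $G$, we have $\gamma^*(G) \leq 2\alpha(G)$.
   Context: All digraphs are finite, loopless and simple, where simple means that for any two vertices $u,v$ there is at most one arc with endpoints $\{u,v\}$. The independence number $\alpha(G)$ of a digraph $G$ is the independence number of its underlying undirected graph. For a vertex $v$, $N^-(v)$ denotes the set of in-neighbors of $v$ and $N^-[v]=N^-(v)\cup\{v\}$. A fractional dominating function of $G=(V,E)$ is a function $g:V\to[0,1]$ such that $\sum_{x\in N^-[v]} g(x)\ge 1$ for every $v\in V$. The fractional domination number $\gamma^*(G)$ is the minimum of $\sum_{v\in V} g(v)$ over all fractional dominating functions $g$ of $G$. -}

module Defs where

open import Data.Nat using (ℕ; zero; suc)
open import Data.Bool using (Bool; true; false; _∨_; if_then_else_)
open import Data.Fin using (Fin; zero; suc; _≟_)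
open import Data.Fin.Subset using (Subset; _∈_; ∣_∣)
open import Data.Rational using (ℚ; 0ℚ; 1ℚ; _+_; _≤_; _/_)
open import Data.Integer using (+_)
open import Data.Product using (Σ; _×_)
open import Relation.Nullary using (does)
open import Relation.Binary.PropositionalEquality using (_≡_)

record Digraph (n : ℕ) : Set where
  field
    arc      : Fin n → Fin n → Bool
    loopless : ∀ v → arc v v ≡ false
    simple   : ∀ u v → arc u v ≡ true → arc v u ≡ false
open Digraph public

adj : ∀ {n} → Digraph n → Fin n → Fin n → Bool
adj G u v = arc G u v ∨ arc G v u

Independent : ∀ {n} → Digraph n → Subset n → Set
Independent G S = ∀ u v → u ∈ S → v ∈ S → adj G u v ≡ false

IsIndependenceNumber : ∀ {n} → Digraph n → ℕ → Set
IsIndependenceNumber {n} G k =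
  Σ (Subset n) (λ S → Independent G S × ∣ S ∣ ≡ k)
  × (∀ S → Independent G S → ∣ S ∣ Data.Nat.≤ k)

sumℚ : ∀ {n} → (Fin n → ℚ) → ℚ
sumℚ {zero}  f = 0ℚ
sumℚ {suc n} f = f zero + sumℚ (λ i → f (suc i))

inClosedIn : ∀ {n} → Digraph n → Fin n → Fin n → Bool
inClosedIn G x v = does (x ≟ v) ∨ arc G x v

closedInSum : ∀ {n} → Digraph n → (Fin n → ℚ) → Fin n → ℚ
closedInSum G g v = sumℚ (λ x → if inClosedIn G x v then g x else 0ℚ)

IsFractionalDominating : ∀ {n} → Digraph n → (Fin n → ℚ) → Set
IsFractionalDominating G g =
  (∀ x → (0ℚ ≤ g x) × (g x ≤ 1ℚ)) × (∀ v → 1ℚ ≤ closedInSum G g v)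

ℕtoℚ : ℕ → ℚ
ℕtoℚ k = + k / 1

{-# OPTIONS --safe #-}
module Submission where

-- Write Y for the total of a weighting y of the N vertices. The Motzkin–Straus inequality bounds Y²
-- by α times the quadratic form of the closed underlying graph, and symmetrising the out-neighbourhood
-- form leaves an extra ∑ y² ≥ Y² / N. Hence, averaging with weights y, some vertex x satisfies
-- 2α y(N⁺[x]) ≥ (1 + 1/N) Y.
-- LP duality would finish the proof; the slack 1/N lets an approximate, purely integral form of
-- duality do so instead (Blackwell approachability): repeatedly play the vertex x that replies best
-- to the current deficits of the vertices. The deficits grow only like the square root of the number
-- of rounds, so after enough rounds the slack absorbs them and the play frequencies, scaled by 2α
-- and cut off at 1, dominate.

open import Defs
open import Data.Nat using (ℕ; _*_)
open import Data.Fin using (Fin)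
open import Data.Rational using (ℚ; _≤_)
open import Data.Product using (Σ; _×_)

open import Algebra.Properties.Semiring.Sum as SemiringSum using ()
open import Data.Bool using (Bool; true; false; _∨_; not; if_then_else_)
open import Data.Bool.Properties using (∨-comm)
open import Data.Fin using (zero; suc)
import Data.Fin as Fin
open import Data.Fin.Properties using (any?; nonZeroIndex)
open import Data.Fin.Subset using (_∈_; _∉_; _⊂_; _∪_; ⁅_⁆; ⊥; ∣_∣)
open import Data.Fin.Subset.Properties using (x∈p∪q⁻; x∈⁅y⁆⇒x≡y; x∈⁅x⁆; p⊆p∪q; q⊆p∪q; p⊂q⇒∣p∣<∣q∣; ∉⊥; ∣⁅x⁆∣≡1)
import Data.Integer as ℤ
import Data.Integer.Properties as ℤ
open import Data.Integer.Tactic.RingSolver using () renaming (solve-∀ to ℤ-solve-∀)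
open import Data.Nat using (zero; suc; _+_; _∸_; _⊓_; _<_; z≤n; s≤s; _≤?_; _<?_; >-nonZero⁻¹)
import Data.Nat as ℕ
open import Data.Nat.Induction using (<-wellFounded)
open import Data.Nat.Properties
open import Data.Nat.Tactic.RingSolver using (solve-∀)
open import Data.Product using (∃; _,_; proj₁; proj₂)
open import Data.Rational using (0ℚ; 1ℚ; _/_; toℚᵘ)
import Data.Rational as ℚ
import Data.Rational.Properties as ℚ
open import Data.Rational.Unnormalised using (mkℚᵘ)
import Data.Rational.Unnormalised as ℚᵘ
import Data.Rational.Unnormalised.Properties as ℚᵘ
open import Data.Sum using (inj₁; inj₂)
open import Function using (mk⇔)
open import Induction.WellFounded using (Acc; acc)
open import Relation.Binary.PropositionalEquality using (_≡_; _≢_; refl; sym; trans; cong; cong₂; subst)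
open import Relation.Nullary using (yes; no; contradiction; does; _×-dec_)
open import Relation.Nullary.Decidable using (dec-true; does-⇔)

open SemiringSum +-*-semiring using (sum; sum-cong-≗; sum-replicate-zero; ∑-distrib-+; ∑-comm; *-distribˡ-sum; *-distribʳ-sum)

private variable
  n : ℕ

-- Finite sums and quadratic inequalities over ℕ

sum-mono-≤ : {f g : Fin n → ℕ} → (∀ i → f i ℕ.≤ g i) → sum f ℕ.≤ sum g
sum-mono-≤ {zero}  f≤g = z≤n
sum-mono-≤ {suc n} f≤g = +-mono-≤ (f≤g zero) (sum-mono-≤ (λ i → f≤g (suc i)))

term≤sum : (f : Fin n → ℕ) (i : Fin n) → f i ℕ.≤ sum f
term≤sum f zero    = m≤m+n _ _
term≤sum f (suc i) = m≤n⇒m≤o+n (f zero) (term≤sum (λ j → f (suc j)) i)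

sum-positive : (f : Fin n → ℕ) → 0 < sum f → ∃ λ i → 0 < f i
sum-positive {suc n} f 0<s with f zero in eq
... | suc _ = zero , subst (0 <_) (sym eq) (s≤s z≤n)
... | zero  with i , 0<fi ← sum-positive (λ j → f (suc j)) 0<s = suc i , 0<fi

2mn≤m²+n² : ∀ m n → 2 * (m * n) ℕ.≤ m * m + n * n
2mn≤m²+n² m n with ≤-total m n
... | inj₁ m≤n with k , refl ← m≤n⇒∃[o]m+o≡n m≤n =
  subst (2 * (m * (m + k)) ℕ.≤_) (expand m k) (m≤m+n _ (k * k))
  where
  expand : ∀ m k → 2 * (m * (m + k)) + k * k ≡ m * m + (m + k) * (m + k)
  expand = solve-∀
... | inj₂ n≤m with k , refl ← m≤n⇒∃[o]m+o≡n n≤m =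
  subst (2 * ((n + k) * n) ℕ.≤_) (expand n k) (m≤m+n _ (k * k))
  where
  expand : ∀ n k → 2 * ((n + k) * n) + k * k ≡ (n + k) * (n + k) + n * n
  expand = solve-∀

-- Expanding the square leaves the cross term `2 * (m * w)`, which is at most `q + s * (m * m)`:
-- apply AM-GM to `s * m` and `w`, then cancel `s`. This one induction step serves both
-- Cauchy-Schwarz and the Motzkin-Straus inequality.
cauchy-step : ∀ m w s q → w * w ℕ.≤ s * q → (m + w) * (m + w) ℕ.≤ suc s * (m * m + q)
cauchy-step m w s q w²≤sq = begin
  (m + w) * (m + w)                        ≡⟨ lhs m w ⟩
  m * m + w * w + 2 * (m * w)              ≤⟨ +-mono-≤ (+-monoʳ-≤ (m * m) w²≤sq) (cross s w²≤sq) ⟩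
  m * m + s * q + (q + s * (m * m))        ≡⟨ rhs m s q ⟩
  suc s * (m * m + q)                      ∎
  where
  open ≤-Reasoning
  lhs : ∀ m w → (m + w) * (m + w) ≡ m * m + w * w + 2 * (m * w)
  lhs = solve-∀
  rhs : ∀ m s q → m * m + s * q + (q + s * (m * m)) ≡ suc s * (m * m + q)
  rhs = solve-∀
  pull : ∀ m w s → s * (2 * (m * w)) ≡ 2 * ((s * m) * w)
  pull = solve-∀
  push : ∀ m s q → (s * m) * (s * m) + s * q ≡ s * (q + s * (m * m))
  push = solve-∀
  cross : ∀ s → w * w ℕ.≤ s * q → 2 * (m * w) ℕ.≤ q + s * (m * m)
  -- There is no `s` to cancel here, but the hypothesis forces `w` to be 0.
  cross zero    w²≤0 with m*n≡0⇒m≡0∨n≡0 w (n≤0⇒n≡0 w²≤0)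
  ... | inj₁ refl = ≤-trans (≤-reflexive (cong (2 *_) (*-zeroʳ m))) z≤n
  ... | inj₂ refl = ≤-trans (≤-reflexive (cong (2 *_) (*-zeroʳ m))) z≤n
  cross s@(suc _) w²≤sq = *-cancelˡ-≤ s (begin
    s * (2 * (m * w))              ≡⟨ pull m w s ⟩
    2 * ((s * m) * w)              ≤⟨ 2mn≤m²+n² (s * m) w ⟩
    (s * m) * (s * m) + w * w      ≤⟨ +-monoʳ-≤ ((s * m) * (s * m)) w²≤sq ⟩
    (s * m) * (s * m) + s * q      ≡⟨ push m s q ⟩
    s * (q + s * (m * m))          ∎)

[∑y]²≤n∑y² : (y : Fin n → ℕ) → sum y * sum y ℕ.≤ n * sum (λ i → y i * y i)
[∑y]²≤n∑y² {zero}  y = z≤n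
[∑y]²≤n∑y² {suc n} y = cauchy-step (y zero) _ n _ ([∑y]²≤n∑y² (λ i → y (suc i)))

-- Weighted Motzkin-Straus inequality

χ : Bool → ℕ
χ b = if b then 1 else 0

χ*n≤n : ∀ b n → χ b * n ℕ.≤ n
χ*n≤n true  n = ≤-reflexive (*-identityˡ n)
χ*n≤n false n = z≤n

χ-split : ∀ b n → χ b * n + χ (not b) * n ≡ n
χ-split true  n = trans (+-identityʳ _) (*-identityˡ n)
χ-split false n = *-identityˡ n

-- With `inClosedIn G` for `E`, this is the weight of the closed out-neighbourhood of `x`, because
-- the second argument of `E` is the one summed over.
nbhd : (Fin n → Fin n → Bool) → (Fin n → ℕ) → Fin n → ℕ
nbhd E y x = sum (λ v → χ (E x v) * y v)

form : (Fin n → Fin n → Bool) → (Fin n → ℕ) → ℕ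
form E y = sum (λ x → y x * nbhd E y x)

minimiser : (y f : Fin n → ℕ) (v : Fin n) → 0 < y v → Acc _<_ (f v) →
            ∃ λ u → 0 < y u × (∀ w → 0 < y w → f u ℕ.≤ f w)
minimiser y f v 0<yv (acc rec) with any? (λ w → (0 <? y w) ×-dec (f w <? f v))
... | yes (w , 0<yw , fw<fv) = minimiser y f w 0<yw (rec fw<fv)
... | no none = v , 0<yv , λ w 0<yw → ≮⇒≥ (λ fw<fv → none (w , 0<yw , fw<fv))

-- Greedy choice as in the Caro–Wei bound: v minimises the weight m of its closed neighbourhood
-- over the support, so deleting that neighbourhood lowers the form by at least m * m.
motzkin-straus : (E : Fin n → Fin n → Bool) → (∀ v → E v v ≡ true) → (∀ u v → E u v ≡ E v u) →
  (y : Fin n → ℕ) → Acc _<_ (sum y) →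
  ∃ λ S → (∀ u → u ∈ S → 0 < y u) × (∀ u v → u ∈ S → v ∈ S → u ≢ v → E u v ≡ false) ×
          sum y * sum y ℕ.≤ ∣ S ∣ * form E y
motzkin-straus {n} E E-refl E-sym y (acc rec) with 0 <? sum y
... | no Y≯0 = ⊥ , (λ u u∈⊥ → contradiction u∈⊥ ∉⊥) , (λ u v u∈⊥ → contradiction u∈⊥ ∉⊥) ,
  ≤-trans (≤-reflexive (cong (λ Y → Y * Y) (n≤0⇒n≡0 (≮⇒≥ Y≯0)))) z≤n
... | yes 0<Y
  with v₀ , 0<yv₀ ← sum-positive y 0<Y
  with v , 0<yv , v-min ← minimiser y (nbhd E y) v₀ 0<yv₀ (<-wellFounded _) = result
  where
  open ≤-Reasoning
  m = nbhd E y v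

  rest : Fin n → ℕ
  rest x = χ (not (E v x)) * y x

  Y≡m+rest : sum y ≡ m + sum rest
  Y≡m+rest = trans (sum-cong-≗ (λ x → sym (χ-split (E v x) (y x)))) (∑-distrib-+ (λ x → χ (E v x) * y x) rest)

  0<m : 0 < m
  0<m = <-≤-trans 0<yv (≤-trans (≤-reflexive (trans (sym (*-identityˡ (y v))) (cong (λ b → χ b * y v) (sym (E-refl v)))))
                                (term≤sum (λ x → χ (E v x) * y x) v))

  rest<Y : sum rest < sum y
  rest<Y = subst (sum rest <_) (sym Y≡m+rest) (m<n+m (sum rest) 0<m)

  rest≤y : ∀ x → rest x ℕ.≤ y x
  rest≤y x = χ*n≤n (not (E v x)) (y x)

  -- Minimality of `v` is known on the support only; off the support both sides vanish.
  y*m≤ : ∀ x → y x * m ℕ.≤ y x * nbhd E y x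
  y*m≤ x with y x in eq
  ... | zero  = z≤n
  ... | suc k = *-monoʳ-≤ (suc k) (v-min x (subst (0 <_) (sym eq) (s≤s z≤n)))

  -- A row of the deleted neighbourhood contributes at least `y x * m` by minimality, and these add
  -- up to `m * m`. Any other row keeps at least its entry in the form of `rest`.
  pointwise : ∀ x → (χ (E v x) * y x) * m + rest x * nbhd E rest x ℕ.≤ y x * nbhd E y x
  pointwise x with E v x
  ... | true  = ≤-trans (≤-reflexive (trans (+-identityʳ _) (cong (_* m) (*-identityˡ (y x))))) (y*m≤ x)
  ... | false = *-mono-≤ (≤-reflexive (*-identityˡ (y x)))
                         (sum-mono-≤ (λ u → *-monoʳ-≤ (χ (E x u)) (rest≤y u)))

  form-drop : m * m + form E rest ℕ.≤ form E y
  form-drop = begin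
    m * m + form E rest
      ≡⟨ cong (_+ form E rest) (*-distribʳ-sum m (λ x → χ (E v x) * y x)) ⟩
    sum (λ x → (χ (E v x) * y x) * m) + form E rest
      ≡⟨ ∑-distrib-+ (λ x → (χ (E v x) * y x) * m) (λ x → rest x * nbhd E rest x) ⟨
    sum (λ x → (χ (E v x) * y x) * m + rest x * nbhd E rest x)
      ≤⟨ sum-mono-≤ pointwise ⟩
    form E y ∎

  -- This is why the induction carries the support condition: the set found for `rest` avoids all
  -- neighbours of `v`, so `v` can be added to it.
  rest-support : ∀ u → 0 < rest u → E v u ≡ false
  rest-support u 0<r with E v u
  ... | false = refl
  ... | true  = contradiction 0<r (λ ())

  result : ∃ λ S → (∀ u → u ∈ S → 0 < y u) × (∀ u v → u ∈ S → v ∈ S → u ≢ v → E u v ≡ false) ×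
                   sum y * sum y ℕ.≤ ∣ S ∣ * form E y
  result with S , supp , indep , bound ← motzkin-straus E E-refl E-sym rest (rec rest<Y) =
    S ∪ ⁅ v ⁆ , supp′ , indep′ , (begin
      sum y * sum y                             ≡⟨ cong (λ Y → Y * Y) Y≡m+rest ⟩
      (m + sum rest) * (m + sum rest)           ≤⟨ cauchy-step m (sum rest) ∣ S ∣ (form E rest) bound ⟩
      -- The inclusion is strict because `v` lies in its own closed neighbourhood and so has weight
      -- 0 in `rest`; this accounts for the `suc`.
      suc ∣ S ∣ * (m * m + form E rest)         ≤⟨ *-mono-≤ (p⊂q⇒∣p∣<∣q∣ S⊂) form-drop ⟩
      ∣ S ∪ ⁅ v ⁆ ∣ * form E y                  ∎)
    where
    v∉S : v ∉ S
    v∉S v∈S = contradiction (trans (sym (E-refl v)) (rest-support v (supp v v∈S))) (λ ())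

    S⊂ : S ⊂ S ∪ ⁅ v ⁆
    S⊂ = p⊆p∪q ⁅ v ⁆ , v , q⊆p∪q S ⁅ v ⁆ (x∈⁅x⁆ v) , v∉S

    supp′ : ∀ u → u ∈ S ∪ ⁅ v ⁆ → 0 < y u
    supp′ u u∈ with x∈p∪q⁻ S ⁅ v ⁆ u∈
    ... | inj₁ u∈S = <-≤-trans (supp u u∈S) (rest≤y u)
    ... | inj₂ u∈v with refl ← x∈⁅y⁆⇒x≡y v u∈v = 0<yv

    indep′ : ∀ u w → u ∈ S ∪ ⁅ v ⁆ → w ∈ S ∪ ⁅ v ⁆ → u ≢ w → E u w ≡ false
    indep′ u w u∈ w∈ u≢w with x∈p∪q⁻ S ⁅ v ⁆ u∈ | x∈p∪q⁻ S ⁅ v ⁆ w∈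
    ... | inj₁ u∈S | inj₁ w∈S = indep u w u∈S w∈S u≢w
    ... | inj₂ u∈v | inj₁ w∈S with refl ← x∈⁅y⁆⇒x≡y v u∈v = rest-support w (supp w w∈S)
    ... | inj₁ u∈S | inj₂ w∈v with refl ← x∈⁅y⁆⇒x≡y v w∈v = trans (E-sym u v) (rest-support u (supp u u∈S))
    ... | inj₂ u∈v | inj₂ w∈v = contradiction (trans (x∈⁅y⁆⇒x≡y v u∈v) (sym (x∈⁅y⁆⇒x≡y v w∈v))) u≢w

-- Approachability by best replies

sum-const : ∀ n k → sum {n} (λ _ → k) ≡ n * k
sum-const zero    k = refl
sum-const (suc n) k = cong (k +_) (sum-const n k)

sum-point : (x : Fin n) (h : Fin n → ℕ) → sum (λ v → χ (does (x Fin.≟ v)) * h v) ≡ h x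
sum-point {suc n} zero    h = trans (cong (1 * h zero +_) (sum-replicate-zero n)) (trans (+-identityʳ _) (*-identityˡ _))
sum-point {suc n} (suc x) h = sum-point x (λ v → h (suc v))

square-cancel-≤ : ∀ m n → m * m ℕ.≤ n * n → m ℕ.≤ n
square-cancel-≤ m n m²≤n² = ≮⇒≥ (λ n<m → <⇒≱ (*-mono-< n<m n<m) m²≤n²)

-- Growth of a squared deficit in one round with demand `a` and payoff `b`. Without truncation,
-- replace `b * y` by `b * (y + a)` and complete the square; with truncation the new deficit is 0
-- and AM-GM suffices. The linear terms stand on opposite sides to avoid subtraction.
potential-step : ∀ y a b → (y + a ∸ b) * (y + a ∸ b) + 2 * (b * y) ℕ.≤ y * y + 2 * (a * y) + (a * a + b * b)
potential-step y a b with ≤-total b (y + a)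
... | inj₁ b≤y+a = begin
  z * z + 2 * (b * y)                    ≤⟨ +-monoʳ-≤ (z * z) (*-monoʳ-≤ 2 (*-monoʳ-≤ b (m≤m+n y a))) ⟩
  z * z + 2 * (b * (y + a))              ≡⟨ cong (λ t → z * z + 2 * (b * t)) z+b ⟨
  z * z + 2 * (b * (z + b))              ≡⟨ regroup z b ⟩
  (z + b) * (z + b) + b * b              ≡⟨ cong (λ t → t * t + b * b) z+b ⟩
  (y + a) * (y + a) + b * b              ≡⟨ expand y a b ⟩
  y * y + 2 * (a * y) + (a * a + b * b)  ∎
  where
  open ≤-Reasoning
  z = y + a ∸ b
  z+b : z + b ≡ y + a
  z+b = m∸n+n≡m b≤y+a
  regroup : ∀ z b → z * z + 2 * (b * (z + b)) ≡ (z + b) * (z + b) + b * b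
  regroup = solve-∀
  expand : ∀ y a b → (y + a) * (y + a) + b * b ≡ y * y + 2 * (a * y) + (a * a + b * b)
  expand = solve-∀
... | inj₂ y+a≤b rewrite m≤n⇒m∸n≡0 y+a≤b = begin
  2 * (b * y)                                ≤⟨ 2mn≤m²+n² b y ⟩
  b * b + y * y                              ≤⟨ m≤m+n _ (2 * (a * y) + a * a) ⟩
  b * b + y * y + (2 * (a * y) + a * a)      ≡⟨ regroup y a b ⟩
  y * y + 2 * (a * y) + (a * a + b * b)      ∎
  where
  open ≤-Reasoning
  regroup : ∀ y a b → b * b + y * y + (2 * (a * y) + a * a) ≡ y * y + 2 * (a * y) + (a * a + b * b)
  regroup = solve-∀

-- Substitute for the minimax theorem: `P` is a payoff matrix, and `respond` provides against every
-- weighting of the columns a row whose weighted payoff meets the demand `a`. The outcome is a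
-- single mixture of rows nearly meeting `a` in every column.
module Approach {m n : ℕ} (P : Fin m → Fin n → ℕ) (a B : ℕ) (P≤B : ∀ x v → P x v ℕ.≤ B)
  (respond : ∀ y → ∃ λ x → a * sum y ℕ.≤ sum (λ v → P x v * y v)) where

  -- Bounds the growth of the sum of squared deficits per round, and is later also the number of
  -- rounds.
  C : ℕ
  C = n * (a * a + B * B)

  -- c x counts how often x has been played; y v is the deficit of v, cut off at 0 in every round.
  -- Replying to the deficits themselves cancels the linear term of their sum of squares.
  play : ∀ T → ∃ λ c → ∃ λ y → sum c ≡ T × (∀ v → a * T ℕ.≤ y v + sum (λ x → c x * P x v)) ×
                                sum (λ v → y v * y v) ℕ.≤ T * C
  play zero = (λ _ → 0) , (λ _ → 0) , sum-replicate-zero m , (λ v → ≤-trans (≤-reflexive (*-zeroʳ a)) z≤n) , ≤-reflexive (sum-replicate-zero n)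
  play (suc T) with c , y , ∑c≡T , covered , small ← play T with x₀ , best ← respond y =
    c′ , y′ , ∑c′ , covered′ , small′
    where
    open ≤-Reasoning
    c′ : Fin m → ℕ
    c′ x = χ (does (x₀ Fin.≟ x)) + c x

    y′ : Fin n → ℕ
    y′ v = y v + a ∸ P x₀ v

    ∑c′ : sum c′ ≡ suc T
    ∑c′ = trans (∑-distrib-+ (λ x → χ (does (x₀ Fin.≟ x))) c)
      (cong₂ _+_ (trans (sum-cong-≗ (λ x → sym (*-identityʳ (χ (does (x₀ Fin.≟ x)))))) (sum-point x₀ (λ _ → 1))) ∑c≡T)

    ∑c′P : ∀ v → sum (λ x → c′ x * P x v) ≡ P x₀ v + sum (λ x → c x * P x v)
    ∑c′P v = trans (sum-cong-≗ (λ x → *-distribʳ-+ (P x v) (χ (does (x₀ Fin.≟ x))) (c x)))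
      (trans (∑-distrib-+ (λ x → χ (does (x₀ Fin.≟ x)) * P x v) (λ x → c x * P x v))
             (cong (_+ sum (λ x → c x * P x v)) (sum-point x₀ (λ x → P x v))))

    covered′ : ∀ v → a * suc T ℕ.≤ y′ v + sum (λ x → c′ x * P x v)
    covered′ v = begin
      a * suc T                              ≡⟨ *-suc a T ⟩
      a + a * T                              ≤⟨ +-monoʳ-≤ a (covered v) ⟩
      a + (y v + s)                          ≡⟨ trans (sym (+-assoc a (y v) s)) (cong (_+ s) (+-comm a (y v))) ⟩
      -- Truncating at 0 can only raise a deficit, so the coverage bound survives.
      y v + a + s                            ≤⟨ +-monoˡ-≤ s (m≤n+m∸n (y v + a) (P x₀ v)) ⟩
      P x₀ v + y′ v + s                      ≡⟨ trans (cong (_+ s) (+-comm (P x₀ v) (y′ v))) (+-assoc (y′ v) (P x₀ v) s) ⟩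
      y′ v + (P x₀ v + s)                    ≡⟨ cong (y′ v +_) (∑c′P v) ⟨
      y′ v + sum (λ x → c′ x * P x v)        ∎
      where s = sum (λ x → c x * P x v)

    sum-2* : (f : Fin n → ℕ) → sum (λ v → 2 * f v) ≡ 2 * sum f
    sum-2* f = sym (*-distribˡ-sum 2 f)

    small′ : sum (λ v → y′ v * y′ v) ℕ.≤ suc T * C
    -- The demand term is added to both sides; `best` exchanges it on the left for the payoff term
    -- that `potential-step` absorbs.
    small′ = +-cancelʳ-≤ (2 * (a * sum y)) _ _ (begin
      sum (λ v → y′ v * y′ v) + 2 * (a * sum y)
        ≤⟨ +-monoʳ-≤ (sum (λ v → y′ v * y′ v)) (*-monoʳ-≤ 2 best) ⟩
      sum (λ v → y′ v * y′ v) + 2 * sum (λ v → P x₀ v * y v)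
        ≡⟨ cong (sum (λ v → y′ v * y′ v) +_) (sum-2* (λ v → P x₀ v * y v)) ⟨
      sum (λ v → y′ v * y′ v) + sum (λ v → 2 * (P x₀ v * y v))
        ≡⟨ ∑-distrib-+ (λ v → y′ v * y′ v) (λ v → 2 * (P x₀ v * y v)) ⟨
      sum (λ v → y′ v * y′ v + 2 * (P x₀ v * y v))
        ≤⟨ sum-mono-≤ (λ v → ≤-trans (potential-step (y v) a (P x₀ v))
             (+-monoʳ-≤ (y v * y v + 2 * (a * y v)) (+-monoʳ-≤ (a * a) (*-mono-≤ (P≤B x₀ v) (P≤B x₀ v))))) ⟩
      sum (λ v → y v * y v + 2 * (a * y v) + (a * a + B * B))
        ≡⟨ ∑-distrib-+ (λ v → y v * y v + 2 * (a * y v)) (λ _ → a * a + B * B) ⟩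
      sum (λ v → y v * y v + 2 * (a * y v)) + sum {n} (λ _ → a * a + B * B)
        ≡⟨ cong₂ _+_ (∑-distrib-+ (λ v → y v * y v) (λ v → 2 * (a * y v))) (sum-const n (a * a + B * B)) ⟩
      sum (λ v → y v * y v) + sum (λ v → 2 * (a * y v)) + C
        ≡⟨ cong (λ t → sum (λ v → y v * y v) + t + C) (trans (sum-2* (λ v → a * y v)) (cong (2 *_) (sym (*-distribˡ-sum a y)))) ⟩
      sum (λ v → y v * y v) + 2 * (a * sum y) + C
        ≤⟨ +-monoˡ-≤ C (+-monoˡ-≤ (2 * (a * sum y)) small) ⟩
      T * C + 2 * (a * sum y) + C
        ≡⟨ regroup (T * C) (2 * (a * sum y)) C ⟩
      suc T * C + 2 * (a * sum y) ∎)
      where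
      regroup : ∀ p q r → p + q + r ≡ r + p + q
      regroup = solve-∀

  -- After C rounds the deficits are at most √(C * C), i.e. 1 per round.
  strategy : ∃ λ c → sum c ≡ C × (∀ v → a * C ℕ.≤ C + sum (λ x → c x * P x v))
  strategy with c , y , ∑c≡C , covered , small ← play C =
    c , ∑c≡C , λ v → ≤-trans (covered v) (+-monoˡ-≤ _
      (square-cancel-≤ (y v) C (≤-trans (term≤sum (λ u → y u * y u) v) small)))

-- Averaging and symmetrisation in the digraph

exceeds-average : Fin n → (y f : Fin n → ℕ) (K : ℕ) → (sum y ≡ 0 → K ≡ 0) →
  sum y * K ℕ.≤ sum (λ x → y x * f x) → ∃ λ x → K ℕ.≤ f x
exceeds-average x₀ y f K Y≡0⇒K≡0 avg with any? (λ x → K ≤? f x)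
... | yes found = found
-- Were every value below `K`, the average would force total weight 0; then `K` is 0 and any vertex,
-- here `x₀`, qualifies.
... | no none = x₀ , subst (ℕ._≤ f x₀) (sym (Y≡0⇒K≡0 Y≡0)) z≤n
  where
  open ≤-Reasoning
  Y≡0 : sum y ≡ 0
  Y≡0 = n≤0⇒n≡0 (+-cancelʳ-≤ (sum (λ x → y x * f x)) _ _ (begin
    sum y + sum (λ x → y x * f x)    ≡⟨ ∑-distrib-+ y (λ x → y x * f x) ⟨
    sum (λ x → y x + y x * f x)      ≡⟨ sum-cong-≗ (λ x → *-suc (y x) (f x)) ⟨
    sum (λ x → y x * suc (f x))      ≤⟨ sum-mono-≤ (λ x → *-monoʳ-≤ (y x) (≰⇒> (λ K≤fx → none (x , K≤fx)))) ⟩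
    sum (λ x → y x * K)              ≡⟨ *-distribʳ-sum K y ⟨
    sum y * K                        ≤⟨ avg ⟩
    sum (λ x → y x * f x)            ∎))

does-≟-sym : (u v : Fin n) → does (u Fin.≟ v) ≡ does (v Fin.≟ u)
does-≟-sym u v = does-⇔ (mk⇔ sym sym) (u Fin.≟ v) (v Fin.≟ u)

closedAdj : Digraph n → Fin n → Fin n → Bool
closedAdj G u v = does (u Fin.≟ v) ∨ adj G u v

module _ (G : Digraph n) where

  closedAdj-refl : ∀ v → closedAdj G v v ≡ true
  closedAdj-refl v = cong (_∨ adj G v v) (dec-true (v Fin.≟ v) refl)

  closedAdj-sym : ∀ u v → closedAdj G u v ≡ closedAdj G v u
  closedAdj-sym u v = cong₂ _∨_ (does-≟-sym u v) (∨-comm (arc G u v) (arc G v u))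

  closedAdj-independent : ∀ S → (∀ u v → u ∈ S → v ∈ S → u ≢ v → closedAdj G u v ≡ false) → Independent G S
  closedAdj-independent S indep u v u∈S v∈S with u Fin.≟ v | indep u v u∈S v∈S
  ... | yes refl | _  = cong₂ _∨_ (loopless G u) (loopless G u)
  ... | no u≢v   | ih = ih u≢v

  [∑y]²≤α*form : ∀ {k} → IsIndependenceNumber G k → ∀ y → sum y * sum y ℕ.≤ k * form (closedAdj G) y
  [∑y]²≤α*form (_ , max) y
    with S , _ , indep , bound ← motzkin-straus (closedAdj G) closedAdj-refl closedAdj-sym y (<-wellFounded _) =
    ≤-trans bound (*-monoˡ-≤ _ (max S (closedAdj-independent S indep)))

  χ-arcs : ∀ p a b → χ (p ∨ (a ∨ b)) + χ p ℕ.≤ χ (p ∨ a) + χ (p ∨ b)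
  χ-arcs true  _     _     = ≤-refl
  χ-arcs false false false = ≤-refl
  χ-arcs false false true  = ≤-refl
  χ-arcs false true  false = ≤-refl
  χ-arcs false true  true  = s≤s z≤n

  -- Add the form of `inClosedIn G` to its transpose: every edge is counted in at least one
  -- direction, while the diagonal is counted twice. The second diagonal is the extra sum of squares
  -- from which the slack comes.
  form-symmetrise : ∀ y → form (closedAdj G) y + sum (λ x → y x * y x) ℕ.≤ 2 * form (inClosedIn G) y
  form-symmetrise y = begin
    form (closedAdj G) y + sum (λ x → y x * y x)
      ≡⟨ cong (form (closedAdj G) y +_) (sum-cong-≗ (λ x → cong (y x *_) (sum-point x y))) ⟨
    form (closedAdj G) y + form (λ x v → does (x Fin.≟ v)) y
      ≡⟨ cong₂ _+_ (as-∑∑ (closedAdj G)) (as-∑∑ (λ x v → does (x Fin.≟ v))) ⟩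
    ∑∑ (closedAdj G) + ∑∑ (λ x v → does (x Fin.≟ v))
      ≡⟨ merge (closedAdj G) (λ x v → does (x Fin.≟ v)) ⟨
    sum (λ x → sum (λ v → (χ (closedAdj G x v) + χ (does (x Fin.≟ v))) * (y x * y v)))
      ≤⟨ sum-mono-≤ (λ x → sum-mono-≤ (λ v → *-monoˡ-≤ (y x * y v) (pointwise x v))) ⟩
    sum (λ x → sum (λ v → (χ (inClosedIn G x v) + χ (inClosedIn G v x)) * (y x * y v)))
      ≡⟨ merge (inClosedIn G) (λ x v → inClosedIn G v x) ⟩
    ∑∑ (inClosedIn G) + ∑∑ (λ x v → inClosedIn G v x)
      ≡⟨ cong (∑∑ (inClosedIn G) +_) transpose ⟩
    ∑∑ (inClosedIn G) + ∑∑ (inClosedIn G)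
      ≡⟨ cong₂ _+_ (as-∑∑ (inClosedIn G)) (trans (+-identityʳ _) (as-∑∑ (inClosedIn G))) ⟨
    2 * form (inClosedIn G) y ∎
    where
    open ≤-Reasoning
    ∑∑ : (Fin n → Fin n → Bool) → ℕ
    ∑∑ E = sum (λ x → sum (λ v → χ (E x v) * (y x * y v)))

    swap : ∀ p q r → p * (q * r) ≡ q * (p * r)
    swap = solve-∀

    as-∑∑ : ∀ E → form E y ≡ ∑∑ E
    as-∑∑ E = sum-cong-≗ (λ x → trans (*-distribˡ-sum (y x) (λ v → χ (E x v) * y v))
                                      (sum-cong-≗ (λ v → swap (y x) (χ (E x v)) (y v))))

    merge : ∀ E F → sum (λ x → sum (λ v → (χ (E x v) + χ (F x v)) * (y x * y v))) ≡ ∑∑ E + ∑∑ F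
    merge E F = trans
      (sum-cong-≗ (λ x → trans (sum-cong-≗ (λ v → *-distribʳ-+ (y x * y v) (χ (E x v)) (χ (F x v))))
        (∑-distrib-+ (λ v → χ (E x v) * (y x * y v)) (λ v → χ (F x v) * (y x * y v)))))
      (∑-distrib-+ (λ x → sum (λ v → χ (E x v) * (y x * y v))) (λ x → sum (λ v → χ (F x v) * (y x * y v))))

    transpose : ∑∑ (λ x v → inClosedIn G v x) ≡ ∑∑ (inClosedIn G)
    transpose = trans (∑-comm (λ x v → χ (inClosedIn G v x) * (y x * y v)))
      (sum-cong-≗ (λ v → sum-cong-≗ (λ x → cong (χ (inClosedIn G v x) *_) (*-comm (y x) (y v)))))

    pointwise : ∀ x v → χ (closedAdj G x v) + χ (does (x Fin.≟ v)) ℕ.≤ χ (inClosedIn G x v) + χ (inClosedIn G v x)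
    pointwise x v rewrite does-≟-sym v x = χ-arcs (does (x Fin.≟ v)) (arc G x v) (arc G v x)

  α-positive : ∀ {k} → IsIndependenceNumber G k → Fin n → 1 ℕ.≤ k
  α-positive (_ , max) v = subst (ℕ._≤ _) (∣⁅x⁆∣≡1 v) (max ⁅ v ⁆ (λ u w u∈ w∈ → indep (x∈⁅y⁆⇒x≡y v u∈) (x∈⁅y⁆⇒x≡y v w∈)))
    where
    indep : ∀ {u w} → u ≡ v → w ≡ v → adj G u w ≡ false
    indep refl refl = cong₂ _∨_ (loopless G v) (loopless G v)

-- Integral domination with slack

module _ {N} (v₀ : Fin N) (G : Digraph N) {k} (α≡k : IsIndependenceNumber G k) where

  private
    -- The factor `N` clears the denominator of 1 + 1/N, so the demand becomes `suc N`.
    B : ℕ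
    B = 2 * k * N

  heavy-out-neighbourhood : ∀ y → ∃ λ x → suc N * sum y ℕ.≤ B * nbhd (inClosedIn G) y x
  heavy-out-neighbourhood y =
    exceeds-average v₀ y (λ x → B * nbhd (inClosedIn G) y x) (suc N * sum y)
      (λ Y≡0 → trans (cong (suc N *_) Y≡0) (*-zeroʳ (suc N))) (begin
      Y * (suc N * Y)                                        ≡⟨ split N Y ⟩
      N * (Y * Y) + 1 * (Y * Y)
        -- The first `N` copies of the squared total use Motzkin-Straus; the remaining one uses
        -- Cauchy-Schwarz and `k` ≥ 1.
        ≤⟨ +-mono-≤ (*-monoʳ-≤ N ([∑y]²≤α*form G α≡k y)) (*-mono-≤ (α-positive G α≡k v₀) ([∑y]²≤n∑y² y)) ⟩
      N * (k * Q) + k * (N * q)                              ≡⟨ factor N k Q q ⟩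
      k * N * (Q + q)                                        ≤⟨ *-monoʳ-≤ (k * N) (form-symmetrise G y) ⟩
      k * N * (2 * form (inClosedIn G) y)                    ≡⟨ move k N (form (inClosedIn G) y) ⟩
      B * form (inClosedIn G) y
        ≡⟨ *-distribˡ-sum B (λ x → y x * nbhd (inClosedIn G) y x) ⟩
      sum (λ x → B * (y x * nbhd (inClosedIn G) y x))
        ≡⟨ sum-cong-≗ (λ x → swap B (y x) (nbhd (inClosedIn G) y x)) ⟩
      sum (λ x → y x * (B * nbhd (inClosedIn G) y x))        ∎)
    where
    open ≤-Reasoning
    Y = sum y
    Q = form (closedAdj G) y
    q = sum (λ x → y x * y x)
    split : ∀ N Y → Y * (suc N * Y) ≡ N * (Y * Y) + 1 * (Y * Y)
    split = solve-∀
    factor : ∀ N k Q q → N * (k * Q) + k * (N * q) ≡ k * N * (Q + q)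
    factor = solve-∀
    move : ∀ k N f → k * N * (2 * f) ≡ 2 * k * N * f
    move = solve-∀
    swap : ∀ p q r → p * (q * r) ≡ q * (p * r)
    swap = solve-∀

  respond : ∀ y → ∃ λ x → suc N * sum y ℕ.≤ sum (λ v → B * χ (inClosedIn G x v) * y v)
  respond y with x , heavy ← heavy-out-neighbourhood y =
    x , ≤-trans heavy (≤-reflexive (trans (*-distribˡ-sum B (λ v → χ (inClosedIn G x v) * y v))
      (sum-cong-≗ (λ v → sym (*-assoc B (χ (inClosedIn G x v)) (y v))))))

  B*χ≤B : ∀ x v → B * χ (inClosedIn G x v) ℕ.≤ B
  B*χ≤B x v = ≤-trans (≤-reflexive (*-comm B (χ (inClosedIn G x v)))) (χ*n≤n (inClosedIn G x v) B)

  open Approach (λ x v → B * χ (inClosedIn G x v)) (suc N) B B*χ≤B respond using (C; strategy)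

  -- The slack in `suc N` is one `C`, exactly the accumulated deficit; what remains is a multiple of
  -- `N` on both sides.
  cancel-deficit : ∀ C (c : Fin N → ℕ) → (∀ v → suc N * C ℕ.≤ C + sum (λ x → c x * (B * χ (inClosedIn G x v)))) →
                   ∀ v → C ℕ.≤ sum (λ x → χ (inClosedIn G x v) * (2 * k * c x))
  cancel-deficit C c covered v = *-cancelˡ-≤ N {{nonZeroIndex v₀}} (+-cancelˡ-≤ C _ _ (begin
    suc N * C                                                    ≤⟨ covered v ⟩
    C + sum (λ x → c x * (B * χ (inClosedIn G x v)))
      ≡⟨ cong (C +_) (sum-cong-≗ (λ x → regroup (c x) k N (χ (inClosedIn G x v)))) ⟩
    C + sum (λ x → N * (χ (inClosedIn G x v) * (2 * k * c x)))
      ≡⟨ cong (C +_) (*-distribˡ-sum N (λ x → χ (inClosedIn G x v) * (2 * k * c x))) ⟨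
    C + N * sum (λ x → χ (inClosedIn G x v) * (2 * k * c x))      ∎))
    where
    open ≤-Reasoning
    regroup : ∀ c k N b → c * (2 * k * N * b) ≡ N * (b * (2 * k * c))
    regroup = solve-∀

  0<C : 0 < C
  0<C = *-mono-≤ (>-nonZero⁻¹ N {{nonZeroIndex v₀}}) (s≤s z≤n)

  -- Divided by `T`, the weights `2 * k * c x` dominate and have total `2 * k`; only the bound 1 on
  -- single values is still to be arranged.
  integral-domination : ∃ λ T → 0 < T × ∃ λ c → sum c ≡ T ×
    (∀ v → T ℕ.≤ sum (λ x → χ (inClosedIn G x v) * (2 * k * c x)))
  integral-domination = C , 0<C , proj₁ strategy , proj₁ (proj₂ strategy) ,
    cancel-deficit C (proj₁ strategy) (proj₂ (proj₂ strategy))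

-- Truncation and passage to rational weights

sum-⊓ : ∀ T (f : Fin n → ℕ) → T ℕ.≤ sum f → T ℕ.≤ sum (λ i → f i ⊓ T)
-- A term reaching `T` survives as `T` and suffices alone; if there is none, nothing is cut off.
sum-⊓ T f T≤∑ with any? (λ i → T ≤? f i)
... | yes (i , T≤fi) = ≤-trans (≤-reflexive (sym (m≥n⇒m⊓n≡n T≤fi))) (term≤sum (λ j → f j ⊓ T) i)
... | no none = ≤-trans T≤∑ (≤-reflexive (sum-cong-≗ (λ i → sym (m≤n⇒m⊓n≡m (≰⇒≥ (λ T≤fi → none (i , T≤fi)))))))

χ-⊓ : ∀ b m T → (χ b * m) ⊓ T ≡ χ b * (m ⊓ T)
χ-⊓ true  m T = trans (cong (_⊓ T) (*-identityˡ m)) (sym (*-identityˡ (m ⊓ T)))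
χ-⊓ false m T = refl

module _ (d : ℕ) where

  private
    D = suc d

  -- One common denominator for all weights reduces sums and comparisons to the numerators.
  frac : ℕ → ℚ
  frac m = ℤ.+ m / D

  toℚᵘ-frac : ∀ m → toℚᵘ (frac m) ℚᵘ.≃ mkℚᵘ (ℤ.+ m) d
  toℚᵘ-frac m = ℚ.toℚᵘ-fromℚᵘ (mkℚᵘ (ℤ.+ m) d)

  frac-*D : ∀ m → frac (m * D) ≡ ℕtoℚ m
  frac-*D m = ℚ.fromℚᵘ-cong {mkℚᵘ (ℤ.+ (m * D)) d} {mkℚᵘ (ℤ.+ m) 0}
    (ℚᵘ.*≡* (trans (ℤ.*-identityʳ (ℤ.+ (m * D))) (ℤ.pos-* m D)))

  frac-D : frac D ≡ 1ℚ
  frac-D = trans (cong frac (sym (*-identityˡ D))) (frac-*D 1)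

  frac-+ : ∀ m n → frac m ℚ.+ frac n ≡ frac (m + n)
  frac-+ m n = ℚ.toℚᵘ-injective (begin
    toℚᵘ (frac m ℚ.+ frac n)                     ≈⟨ ℚ.toℚᵘ-homo-+ (frac m) (frac n) ⟩
    toℚᵘ (frac m) ℚᵘ.+ toℚᵘ (frac n)             ≈⟨ ℚᵘ.+-cong (toℚᵘ-frac m) (toℚᵘ-frac n) ⟩
    mkℚᵘ (ℤ.+ m) d ℚᵘ.+ mkℚᵘ (ℤ.+ n) d           ≈⟨ ℚᵘ.*≡* (common (ℤ.+ m) (ℤ.+ n) (ℤ.+ D)) ⟩
    mkℚᵘ (ℤ.+ (m + n)) d                         ≈⟨ toℚᵘ-frac (m + n) ⟨
    toℚᵘ (frac (m + n))                          ∎)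
    where
    open import Relation.Binary.Reasoning.Setoid ℚᵘ.≃-setoid
    common : ∀ a b c → (a ℤ.* c ℤ.+ b ℤ.* c) ℤ.* c ≡ (a ℤ.+ b) ℤ.* (c ℤ.* c)
    common = ℤ-solve-∀

  frac-mono-≤ : ∀ m n → m ℕ.≤ n → frac m ≤ frac n
  frac-mono-≤ m n m≤n = ℚ.toℚᵘ-cancel-≤ (begin
    toℚᵘ (frac m)      ≃⟨ toℚᵘ-frac m ⟩
    mkℚᵘ (ℤ.+ m) d     ≤⟨ ℚᵘ.*≤* (ℤ.*-monoʳ-≤-nonNeg (ℤ.+ D) (ℤ.+≤+ m≤n)) ⟩
    mkℚᵘ (ℤ.+ n) d     ≃⟨ toℚᵘ-frac n ⟨
    toℚᵘ (frac n)      ∎)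
    where open ℚᵘ.≤-Reasoning

  sumℚ-frac : (g : Fin n → ℚ) (f : Fin n → ℕ) → (∀ i → g i ≡ frac (f i)) → sumℚ g ≡ frac (sum f)
  sumℚ-frac {zero}  g f g≡f = sym (frac-*D 0)
  sumℚ-frac {suc n} g f g≡f = trans
    (cong₂ ℚ._+_ (g≡f zero) (sumℚ-frac (λ i → g (suc i)) (λ i → f (suc i)) (λ i → g≡f (suc i))))
    (frac-+ (f zero) _)

  if-frac : ∀ b m → (if b then frac m else 0ℚ) ≡ frac (χ b * m)
  if-frac true  m = cong frac (sym (*-identityˡ m))
  if-frac false m = sym (frac-*D 0)

normalise : (G : Digraph n) (k T : ℕ) → 0 < T → (c : Fin n → ℕ) → sum c ≡ T →
  (∀ v → T ℕ.≤ sum (λ x → χ (inClosedIn G x v) * (2 * k * c x))) →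
  Σ (Fin n → ℚ) (λ g → IsFractionalDominating G g × (sumℚ g ≤ ℕtoℚ (2 * k)))
normalise {n} G k (suc d) _ c ∑c≡D covered = g , (bounds , dominates) , weight
  where
  D = suc d

  -- The cut at `D` is a cut at the value 1.
  e : Fin n → ℕ
  e x = (2 * k * c x) ⊓ D

  g : Fin n → ℚ
  g x = frac d (e x)

  bounds : ∀ x → (0ℚ ≤ g x) × (g x ≤ 1ℚ)
  bounds x = subst (_≤ g x) (frac-*D d 0) (frac-mono-≤ d 0 (e x) z≤n) ,
             subst (g x ≤_) (frac-D d) (frac-mono-≤ d (e x) D (m⊓n≤n (2 * k * c x) D))

  dominates : ∀ v → 1ℚ ≤ closedInSum G g v
  dominates v = begin
    1ℚ                                                      ≡⟨ frac-D d ⟨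
    frac d D                                                ≤⟨ frac-mono-≤ d D _ (sum-⊓ D (λ x → χ (inClosedIn G x v) * (2 * k * c x)) (covered v)) ⟩
    frac d (sum (λ x → (χ (inClosedIn G x v) * (2 * k * c x)) ⊓ D))
      ≡⟨ cong (frac d) (sum-cong-≗ (λ x → χ-⊓ (inClosedIn G x v) (2 * k * c x) D)) ⟩
    frac d (sum (λ x → χ (inClosedIn G x v) * e x))
      ≡⟨ sumℚ-frac d _ (λ x → χ (inClosedIn G x v) * e x) (λ x → if-frac d (inClosedIn G x v) (e x)) ⟨
    closedInSum G g v                                       ∎
    where open ℚ.≤-Reasoning

  weight : sumℚ g ≤ ℕtoℚ (2 * k)
  weight = begin
    sumℚ g                               ≡⟨ sumℚ-frac d g e (λ _ → refl) ⟩
    frac d (sum e)                       ≤⟨ frac-mono-≤ d (sum e) _ (sum-mono-≤ (λ x → m⊓n≤m (2 * k * c x) D)) ⟩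
    frac d (sum (λ x → 2 * k * c x))     ≡⟨ cong (frac d) (*-distribˡ-sum (2 * k) c) ⟨
    frac d (2 * k * sum c)               ≡⟨ cong (λ s → frac d (2 * k * s)) ∑c≡D ⟩
    frac d (2 * k * D)                   ≡⟨ frac-*D d (2 * k) ⟩
    ℕtoℚ (2 * k)                         ∎
    where open ℚ.≤-Reasoning

theorem1 : (n : ℕ) (G : Digraph n) (k : ℕ) → IsIndependenceNumber G k →
    Σ (Fin n → ℚ) (λ g → IsFractionalDominating G g × (sumℚ g ≤ ℕtoℚ (2 * k)))
-- The averaging argument needs a vertex, so the empty digraph is settled by the empty function.
theorem1 zero    G k α≡k = (λ ()) , ((λ ()) , (λ ())) , ℚ.nonNegative⁻¹ (ℕtoℚ (2 * k)) {{ℚ.normalize-nonNeg (2 * k) 1}}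
theorem1 (suc n) G k α≡k =
  let T , 0<T , c , ∑c≡T , covered = integral-domination zero G α≡k in normalise G k T 0<T c ∑c≡T covered
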